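{- Let $S$ be a compact connected polygonal surface with boundary in $\mathbb{R}^2$ corresponding to a framework $F(S)$ (orientable or non-orientable), and let $b_1(S)$ be the first Betti number of $S$. Assume that the dimension of the space of self-stresses on $F(S)$ equals $d$ and that $d>3b_1(S)$. Then there exists a non-trivial monodromy-free polyhedral lifting of $F(S)$; that is, there exists a non-zero self-stress $w$ on $F(S)$ that is monodromy-free, so that the lifting $\tau_{w,f}$ of $S$ with respect to $w$ and a face $f$ is defined.
   Context: Polygonal surfaces. A polygon in $\mathbb{R}^n$ is flat if all its vertices lie in one two-dimensional plane and its boundary has no self-intersections (it need not be convex). A polygonal surface (with boundary) in $\mathbb{R}^n$, $n\ge 2$, is a mapping of a CW-complex of a surface (with boundary) to $\mathbb{R}^n$ such that each face corresponds to a flat polygon. Self-intersections of the image are allowed. Surfaces are compact, and their boundary is homeomorphic to a disjoint (possibly empty) collection of circles. The framework $F(S)$ is the 1-skeleton of $S$: a finite connected graph without loops and multiple edges whose vertices $v_i$ are placed at points $p_i\in\mathbb{R}^2$ and whose edges are straight segments. Self-stresses. A stress $w$ on $F(S)$ assigns a real number $w_{ij}=w_{ji}$ to each edge $p_ip_j$ (also written $w(p_ip_j)$). It is a self-stress if $\sum_{\{j\,:\,v_iv_j \text{ an edge}\}} w_{ij}(p_i-p_j)=0$ at every vertex $v_i$. Face-paths. A face-path $\gamma$ of length $N\geq 1$ from $f_0$ to $f_N$ is a sequence of faces $(f_0,\dots,f_N)$ of $S$ together with a sequence of edges $(p_1q_1,\dots,p_Nq_N)$ such that $p_iq_i$ is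 a common edge of $f_{i-1}$ and $f_i$ for all $i$ (if $f_{i-1}=f_i$, any edge of that face is allowed). It is a face-loop if $f_0=f_N$. A face is oriented if its edges are oriented so as to form an oriented loop. The orientations of two distinct faces agree at a common edge $e$ if their oriented edge loops pass $e$ in opposite directions. The face-path is oriented if each of its faces and edges is oriented so that the orientations of consecutive distinct faces $f_{i-1},f_i$ agree at $p_iq_i$ (a repeated face $f_{i-1}=f_i$ keeps its orientation), and the edge $p_iq_i$ is oriented from $p_i$ to $q_i$ by the orientation of $f_{i-1}$. Orientations are attached to the entries of the path, not to the faces of $S$, so on a non-orientable surface a path may visit the same face with opposite orientations. Lifts. For a step $i$ of an oriented face-path, the elementary lift is the linear (i.e. affine) function on $\mathbb{R}^2$ $$L_{f_{i-1}}^{f_i}(p)=\det(p_i-q_i,\;p_i-p)\cdot w(p_iq_i)\cdot\rho(f_{i-1},f_i),$$ where $\rho(f,g)=1$ if $f,g$ are different faces of $S$ and $\rho(f,g)=0$ otherwise. The lift from $f_0$ to $f_N$ with respect to $\gamma$ and $w$ is $\tau_{\gamma,w}(f_0,f_N)=\sum_{i=1}^N L_{f_{i-1}}^{f_i}$. Monodromy-free self-stresses and liftings. A self-stress $w$ on $F(S)$ is monodromy-free if $\tau_{\gamma,w}(f,f)=0$ for any face $f$ of $S$ and any oriented face-loop $\gamma$ starting and ending at $f$. For monodromy-free $w$ one sets $\tau_w(f,f')=\tau_{\gamma,w}(f,f')$ for any oriented face-path $\gamma$ connecting $f$ and $f'$. The lifting of $S$ with respect to $w,f$ is the function $\tau_{w,f}:S\to\mathbb{R}$,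 $\tau_{w,f}(p)=\tau_w(f,f_p)(p)$, where $f_p$ is the face containing $p$ (and the affine function is evaluated at the position of $p$ in $\mathbb{R}^2$).
   Formalization: On non-orientable S, monodromy-free is required only for oriented face-loops returning to f with the same orientation, and the lifting is attached to oriented faces; if orientation-reversing loops counted, the claim would fail (e.g. the 6-vertex projective plane in generic position). -}

module Defs where

open import Algebra.Bundles using (CommutativeRing)
open import Algebra.Structures using (IsCommutativeRing)
open import Data.Fin.Base using (Fin; toℕ)
open import Data.Fin.Properties using (_≟_)
open import Data.Nat.Base as ℕ using (ℕ; zero; suc)
open import Data.Nat.DivMod using (_mod_)
open import Data.Product using (Σ; ∃; ∃₂; _×_; _,_; proj₁; proj₂)
open import Data.Sign.Base as Sign using (Sign; opposite)
open import Data.Sum.Base using (_⊎_)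
open import Level using (0ℓ)
open import Relation.Binary.Construct.Closure.Equivalence using (EqClosure)
open import Relation.Binary.Construct.Closure.ReflexiveTransitive using (Star)
open import Relation.Binary.Construct.Closure.Transitive using (TransClosure; [_]; _∷_)
open import Relation.Binary.PropositionalEquality using (_≡_; _≢_)
open import Relation.Binary.Structures using (IsStrictTotalOrder)
open import Relation.Nullary using (¬_; does)
open import Data.Bool.Base using (if_then_else_)
import Algebra.Properties.CommutativeMonoid.Sum as Sum

-- The real numbers, given by their classical axioms: a Dedekind-complete
-- totally ordered field.  Equality is decidable, because the strict order is
-- trichotomous.
record Reals : Set₁ where
  infixl 6 _+_ _-_
  infixl 7 _*_
  infix  8 -_
  infix  4 _<_ _≤_
  field
    ℝ       : Set
    _+_ _*_ : ℝ → ℝ → ℝ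
    -_      : ℝ → ℝ
    0# 1#   : ℝ
    _<_     : ℝ → ℝ → Set

  _≤_ : ℝ → ℝ → Set
  x ≤ y = ¬ (y < x)

  _-_ : ℝ → ℝ → ℝ
  x - y = x + (- y)

  UpperBound : (ℝ → Set) → ℝ → Set
  UpperBound P u = ∀ x → P x → x ≤ u

  field
    isCommutativeRing  : IsCommutativeRing _≡_ _+_ _*_ -_ 0# 1#
    isStrictTotalOrder : IsStrictTotalOrder _≡_ _<_
    0≢1                : 0# ≢ 1#
    inverse            : ∀ x → x ≢ 0# → ∃ λ y → x * y ≡ 1#
    +-monoˡ-<          : ∀ x {y z} → y < z → y + x < z + x
    *-pos              : ∀ {x y} → 0# < x → 0# < y → 0# < x * y
    supremum           : (P : ℝ → Set) → ∃ P → ∃ (UpperBound P) →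
                         ∃ λ s → UpperBound P s × (∀ u → UpperBound P u → s ≤ u)

  commutativeRing : CommutativeRing 0ℓ 0ℓ
  commutativeRing = record { isCommutativeRing = isCommutativeRing }

  open Sum (CommutativeRing.+-commutativeMonoid commutativeRing) public using (sum)

-- Cyclic successor on the sides of a polygon.
next : ∀ {n} → Fin n → Fin n
next {suc n} i = suc (toℕ i) mod suc n

start : {A : Set} → Sign → A × A → A
start Sign.+ = proj₁
start Sign.- = proj₂

-- A finite connected CW-complex whose underlying space is a surface with
-- (possibly empty) boundary, with a simple graph as its 1-skeleton.  Cells are
-- indexed by Fin.  A dart (e , s) is an edge with a direction, Sign.+ being the
-- arbitrary reference direction; an edge carries the two darts (e , ±).
record SurfaceComplex : Set where
  field
    #V #E #F : ℕ
    ends     : Fin #E → Fin #V × Fin #V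

  Dart : Set
  Dart = Fin #E × Sign

  edge : Dart → Fin #E
  edge = proj₁

  tail : Dart → Fin #V
  tail (e , s) = start s (ends e)

  head : Dart → Fin #V
  head (e , s) = start (opposite s) (ends e)

  rev : Dart → Dart
  rev (e , s) = e , opposite s

  Adjacent : Fin #V → Fin #V → Set
  Adjacent u v = ∃ λ a → tail a ≡ u × head a ≡ v

  field
    loopless        : ∀ a → tail a ≢ head a
    noMultipleEdges : ∀ a b → tail a ≡ tail b → head a ≡ head b → a ≡ b
    connected       : ∀ u v → Star Adjacent u v

    -- The attaching map of a face: a closed walk in the 1-skeleton.
    size   : Fin #F → ℕ
    3≤size : ∀ f → 3 ℕ.≤ size f
    side   : ∀ f → Fin (size f) → Dart
    closed : ∀ f i → head (side f i) ≡ tail (side f (next i))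

  Side : Set
  Side = Σ (Fin #F) λ f → Fin (size f)

  edgeOf : Side → Fin #E
  edgeOf (f , i) = edge (side f i)

  -- The arcs of vertex links: a and b leave the same vertex along two
  -- successive sides of a face.
  Corner : Dart → Dart → Set
  Corner a b = ∃₂ λ f i → rev (side f i) ≡ a × side f (next i) ≡ b

  -- Every point has a disk or half-disk neighbourhood.  At an edge: it occurs
  -- once or twice among all sides of faces.  At a vertex: the link is nonempty
  -- and connected; as its nodes have degree 1 or 2 by the edge condition,
  -- it is then a path or a cycle.
  field
    edgeCovered   : ∀ e → ∃ λ (x : Side) → edgeOf x ≡ e
    atMostTwice   : ∀ x y z → edgeOf x ≡ edgeOf y → edgeOf y ≡ edgeOf z →
                    x ≡ y ⊎ y ≡ z ⊎ x ≡ z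
    vertexCovered : ∀ v → ∃ λ a → tail a ≡ v
    linkConnected : ∀ a b → tail a ≡ tail b → EqClosure Corner a b

module Plane (R : Reals) where
  open Reals R

  ℝ² : Set
  ℝ² = ℝ × ℝ

  infixl 6 _⊖_
  _⊖_ : ℝ² → ℝ² → ℝ²
  (a , b) ⊖ (c , d) = (a - c) , (b - d)

  det : ℝ² → ℝ² → ℝ
  det (a , b) (c , d) = a * d - b * c

  along : ℝ² → ℝ² → ℝ → ℝ²
  along (a , b) (c , d) t = (a + t * (c - a)) , (b + t * (d - b))

-- A polygonal surface in the plane.  Flatness of a face reduces to: its closed
-- boundary polyline, parametrised side by side over half-open unit intervals,
-- is injective.  Distinct faces may overlap, and vertices may coincide in ℝ².
record PolygonalSurface (R : Reals) : Set where
  open Reals R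
  open Plane R
  field
    complex : SurfaceComplex
  open SurfaceComplex complex public
  field
    pos : Fin #V → ℝ²

  onDart : Dart → ℝ → ℝ²
  onDart a = along (pos (tail a)) (pos (head a))

  field
    noSelfIntersection :
      ∀ f i j s t → 0# ≤ s → s < 1# → 0# ≤ t → t < 1# →
      onDart (side f i) s ≡ onDart (side f j) t → i ≡ j × s ≡ t

module LinearAlgebra (R : Reals) where
  open Reals R

  combination : ∀ {m n} → (Fin m → ℝ) → (Fin m → Fin n → ℝ) → Fin n → ℝ
  combination c v i = sum λ k → c k * v k i

  -- dim (Z / B) = d, for subspaces B ⊆ Z of ℝⁿ: some d vectors of Z form a
  -- basis modulo B.
  QuotientDimension : ∀ {n} → (Z B : (Fin n → ℝ) → Set) → ℕ → Set
  QuotientDimension {n} Z B d =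
    ∃ λ (v : Fin d → Fin n → ℝ) →
      (∀ k → Z (v k)) ×
      (∀ c → B (combination c v) → ∀ k → c k ≡ 0#) ×
      (∀ z → Z z → ∃ λ c → B (λ i → z i - combination c v i))

  Dimension : ∀ {n} → ((Fin n → ℝ) → Set) → ℕ → Set
  Dimension Z = QuotientDimension Z (λ z → ∀ i → z i ≡ 0#)

module _ {R : Reals} (S : PolygonalSurface R) where
  open Reals R
  open Plane R
  open LinearAlgebra R
  open PolygonalSurface S

  -- Cellular homology with real coefficients.

  signed : Sign → ℝ → ℝ
  signed Sign.+ x = x
  signed Sign.- x = - x

  [_at_] : Fin #V → Fin #V → ℝ
  [ u at v ] = if does (u ≟ v) then 1# else 0#

  ∂₁ : (Fin #E → ℝ) → Fin #V → ℝ
  ∂₁ c v = sum λ e →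
    c e * ([ head (e , Sign.+) at v ] - [ tail (e , Sign.+) at v ])

  incidence : Dart → Fin #E → ℝ
  incidence (e′ , s) e = if does (e′ ≟ e) then signed s 1# else 0#

  ∂₂ : (Fin #F → ℝ) → Fin #E → ℝ
  ∂₂ x e = sum λ f → x f * sum λ i → incidence (side f i) e

  IsCycle IsBoundary : (Fin #E → ℝ) → Set
  IsCycle    c = ∀ v → ∂₁ c v ≡ 0#
  IsBoundary c = ∃ λ x → ∀ e → ∂₂ x e ≡ c e

  FirstBetti : ℕ → Set
  FirstBetti = QuotientDimension IsCycle IsBoundary

  -- A stress is one real per undirected edge, so w_ij = w_ji is built in.
  Stress : Set
  Stress = Fin #E → ℝ

  -- w_ij (p_i - p_j) for the dart a from v_i to v_j if v_i = v, and 0 otherwise.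
  force : Stress → Fin #V → Dart → ℝ²
  force w v a = let (x , y) = pos (tail a) ⊖ pos (head a) in
    if does (tail a ≟ v) then (w (edge a) * x , w (edge a) * y) else (0# , 0#)

  SelfStress : Stress → Set
  SelfStress w = ∀ v →
    total (λ a → proj₁ (force w v a)) ≡ 0# × total (λ a → proj₂ (force w v a)) ≡ 0#
    where
    total : (Dart → ℝ) → ℝ
    total g = sum λ e → g (e , Sign.+) + g (e , Sign.-)

  -- A face with one of its two orientations; Sign.+ is the direction in which
  -- its sides are listed.
  OrientedFace : Set
  OrientedFace = Fin #F × Sign

  infix 4 _∈∂_
  _∈∂_ : Dart → OrientedFace → Set
  a ∈∂ (f , Sign.+) = ∃ λ i → side f i ≡ a
  a ∈∂ (f , Sign.-) = ∃ λ i → rev (side f i) ≡ a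

  -- One step of an oriented face-path.  The dart is the edge p_i q_i directed
  -- by the orientation of the face being left; between distinct faces
  -- orientations must agree, i.e. the new face traverses the edge oppositely.
  data Step : OrientedFace → OrientedFace → Set where
    cross : ∀ {f g s t} (a : Dart) → f ≢ g →
            a ∈∂ (f , s) → rev a ∈∂ (g , t) → Step (f , s) (g , t)
    stay  : ∀ {f s} (a : Dart) → a ∈∂ (f , s) → Step (f , s) (f , s)

  dart : ∀ {φ ψ} → Step φ ψ → Dart
  dart (cross a _ _ _) = a
  dart (stay a _)      = a

  ρ : ∀ {φ ψ} → Step φ ψ → ℝ
  ρ (cross _ _ _ _) = 1#
  ρ (stay _ _)      = 0#

  OrientedFacePath : OrientedFace → OrientedFace → Set
  OrientedFacePath = TransClosure Step

  elementaryLift : ∀ {φ ψ} → Stress → Step φ ψ → ℝ² → ℝ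
  elementaryLift w σ x =
    det (p ⊖ q) (p ⊖ x) * w (edge (dart σ)) * ρ σ
    where
    p = pos (tail (dart σ))
    q = pos (head (dart σ))

  τ : ∀ {φ ψ} → OrientedFacePath φ ψ → Stress → ℝ² → ℝ
  τ [ σ ]   w x = elementaryLift w σ x
  τ (σ ∷ γ) w x = elementaryLift w σ x + τ γ w x

  -- A loop of oriented faces: the path returns to f with the orientation it
  -- started with (automatic if the surface is orientable).  A path returning
  -- with the reversed orientation does not close up as an oriented loop; if
  -- τ had to vanish on these as well, w would be forced to be zero on every
  -- interior edge of every non-orientable surface.
  MonodromyFree : Stress → Set
  MonodromyFree w = ∀ φ (γ : OrientedFacePath φ φ) x → τ γ w x ≡ 0#

  -- The lifting with respect to w is defined: every face g is reached by an
  -- oriented face-path, τ depends only on the oriented faces joined, and the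
  -- values obtained from two agreeing faces coincide along a common edge (hence,
  -- going around links, also at vertices).
  record LiftingDefined (w : Stress) : Set where
    field
      reachable   : ∀ φ g → ∃ λ t → OrientedFacePath φ (g , t)
      independent : ∀ {φ ψ} (γ γ′ : OrientedFacePath φ ψ) x → τ γ w x ≡ τ γ′ w x
      compatible  : ∀ {φ g h t u} (γ : OrientedFacePath φ (g , t))
                    (γ′ : OrientedFacePath φ (h , u)) (a : Dart) →
                    g ≢ h → a ∈∂ (g , t) → rev a ∈∂ (h , u) →
                    ∀ r → 0# ≤ r → r ≤ 1# →
                    τ γ w (onDart a r) ≡ τ γ′ w (onDart a r)

module Submission where

-- Fix a point x.  Weighting each edge pq by det (p - q , p - x) * w(pq) gives a
-- cellular 1-chain, and the equilibrium of w makes it a cycle.  If that chain is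
-- the boundary of a 2-chain y, then y, with sign according to orientation, is a
-- potential for the lift: each crossing changes it by the elementary lift.  Hence
-- τ telescopes and w is monodromy-free, whether or not S is orientable.  The chain
-- is affine in x, so it bounds for all x once its classes in H₁ vanish at three
-- affinely independent points.  These are 3 b₁ linear conditions on a space of
-- self-stresses of dimension d > 3 b₁.

open import Defs
open import Algebra.Bundles using (CommutativeRing)
open import Algebra.Solver.Ring.AlmostCommutativeRing using (fromCommutativeRing; _-Raw-AlmostCommutative⟶_)
open import Data.Bool.Base using (true; false; if_then_else_)
open import Data.Fin.Base using (Fin; zero; suc; punchIn; punchOut; combine; remQuot; fromℕ<)
open import Data.Fin.Properties
  using (_≟_; all?; ¬∀⟶∃¬; punchIn-punchOut; punchInᵢ≢i; punchIn-injective; remQuot-combine)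
open import Data.Integer.Base as ℤ using (ℤ; 0ℤ; 1ℤ)
import Data.Integer.Properties as ℤ
open import Data.Maybe.Base using (Maybe; just; nothing)
open import Data.Nat.Base as ℕ using (ℕ; zero; suc; s<s; s≤s; z≤n)
open import Data.Nat.Properties using (m<n⇒m<1+n; ≤-trans)
open import Data.Product using (∃; _×_; _,_; proj₁; proj₂)
open import Data.Sign.Base as Sign using (Sign; opposite)
open import Data.Sign.Properties using (opposite-involutive)
open import Data.Sum.Base using (inj₁; inj₂)
open import Data.Vec.Functional using (insertAt; removeAt)
open import Data.Vec.Functional.Properties using (insertAt-lookup; insertAt-punchIn)
open import Function.Base using (_∘_)
open import Relation.Binary.Construct.Closure.Equivalence using (EqClosure)
open import Relation.Binary.Construct.Closure.ReflexiveTransitive using (Star; ε; _◅_)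
open import Relation.Binary.Construct.Closure.Symmetric using (fwd; bwd)
open import Relation.Binary.Construct.Closure.Transitive using ([_]; _∷_; _∷ʳ_)
open import Relation.Binary.PropositionalEquality hiding ([_])
open import Relation.Binary.Structures using (IsStrictTotalOrder)
open import Relation.Nullary using (¬_; yes; no; does; contradiction)
open import Relation.Nullary.Decidable using (dec-true; dec-false)
import Algebra.Properties.Ring as RingProperties
import Algebra.Properties.Semiring.Mult.TCOptimised as Mult
import Algebra.Properties.Semiring.Sum as SemiringSum
import Algebra.Solver.Ring as RingSolver

-- The canonical homomorphism from the integers to the reals.

-- The ring solver needs coefficients with decidable equality that computes,
-- which rules out the abstract reals themselves.
module IntegerCoefficients (R : Reals) where
  open Reals R
  open import Data.Integer.Base using (+_; -[1+_])
  private module CR = CommutativeRing commutativeRing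
  open RingProperties CR.ring using (-‿distribˡ-*; -‿distribʳ-*; -‿involutive; -0#≈0#; -‿+-comm)
  open Mult CR.semiring renaming (_×_ to _∙_)
  open ≡-Reasoning

  fromℤ : ℤ → ℝ
  fromℤ (+ n)    = n ∙ 1#
  fromℤ -[1+ n ] = - (suc n ∙ 1#)

  fromℤ-neg : ∀ i → fromℤ (ℤ.- i) ≡ - fromℤ i
  fromℤ-neg (+ zero)  = sym -0#≈0#
  fromℤ-neg (+ suc n) = refl
  fromℤ-neg -[1+ n ]  = sym (-‿involutive _)

  -- Integer addition of mixed signs computes by `⊖`; cancelling a common successor there amounts to
  -- inserting `1# - 1#` here.
  fromℤ-⊖ : ∀ m n → fromℤ (m ℤ.⊖ n) ≡ m ∙ 1# - n ∙ 1#
  fromℤ-⊖ m zero = sym (trans (cong (λ z → m ∙ 1# + z) -0#≈0#) (CR.+-identityʳ _))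
  fromℤ-⊖ zero (suc n) = sym (CR.+-identityˡ _)
  fromℤ-⊖ (suc m) (suc n) = begin
    fromℤ (suc m ℤ.⊖ suc n)                ≡⟨ cong fromℤ (ℤ.[1+m]⊖[1+n]≡m⊖n m n) ⟩
    fromℤ (m ℤ.⊖ n)                        ≡⟨ fromℤ-⊖ m n ⟩
    m ∙ 1# - n ∙ 1#                        ≡⟨ cong (λ z → z - n ∙ 1#) (CR.+-identityʳ _) ⟨
    m ∙ 1# + 0# - n ∙ 1#                   ≡⟨ cong (λ z → m ∙ 1# + z - n ∙ 1#) (CR.-‿inverseʳ 1#) ⟨
    m ∙ 1# + (1# - 1#) - n ∙ 1#            ≡⟨ cong (λ z → z - n ∙ 1#) (CR.+-assoc _ _ _) ⟨
    m ∙ 1# + 1# - 1# - n ∙ 1#              ≡⟨ CR.+-assoc _ _ _ ⟩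
    m ∙ 1# + 1# + (- 1# - n ∙ 1#)          ≡⟨ cong₂ _+_ (CR.+-comm _ _) (-‿+-comm _ _) ⟩
    1# + m ∙ 1# - (1# + n ∙ 1#)            ≡⟨ cong₂ _-_ (1+× m 1#) (1+× n 1#) ⟨
    suc m ∙ 1# - suc n ∙ 1#                ∎

  fromℤ-+ : ∀ i j → fromℤ (i ℤ.+ j) ≡ fromℤ i + fromℤ j
  fromℤ-+ (+ m)    (+ n)    = ×-homo-+ 1# m n
  fromℤ-+ (+ m)    -[1+ n ] = fromℤ-⊖ m (suc n)
  fromℤ-+ -[1+ m ] (+ n)    = trans (fromℤ-⊖ n (suc m)) (CR.+-comm _ _)
  fromℤ-+ -[1+ m ] -[1+ n ] = begin
    fromℤ (-[1+ m ] ℤ.+ -[1+ n ])          ≡⟨ cong fromℤ (ℤ.neg-distrib-+ (+ suc m) (+ suc n)) ⟨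
    - ((suc m ℕ.+ suc n) ∙ 1#)             ≡⟨ cong -_ (×-homo-+ 1# (suc m) (suc n)) ⟩
    - (suc m ∙ 1# + suc n ∙ 1#)            ≡⟨ -‿+-comm _ _ ⟨
    fromℤ -[1+ m ] + fromℤ -[1+ n ]        ∎

  fromℤ-pos-* : ∀ m j → fromℤ (+ m ℤ.* j) ≡ m ∙ 1# * fromℤ j
  fromℤ-pos-* m (+ n) = trans (cong fromℤ (sym (ℤ.pos-* m n))) (×1-homo-* m n)
  fromℤ-pos-* m -[1+ n ] = begin
    fromℤ (+ m ℤ.* -[1+ n ])               ≡⟨ cong fromℤ (ℤ.neg-distribʳ-* (+ m) (+ suc n)) ⟨
    fromℤ (ℤ.- (+ m ℤ.* + suc n))          ≡⟨ fromℤ-neg (+ m ℤ.* + suc n) ⟩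
    - fromℤ (+ m ℤ.* + suc n)              ≡⟨ cong -_ (fromℤ-pos-* m (+ suc n)) ⟩
    - (m ∙ 1# * suc n ∙ 1#)                ≡⟨ -‿distribʳ-* _ _ ⟩
    m ∙ 1# * fromℤ -[1+ n ]                ∎

  fromℤ-* : ∀ i j → fromℤ (i ℤ.* j) ≡ fromℤ i * fromℤ j
  fromℤ-* (+ m)    j = fromℤ-pos-* m j
  fromℤ-* -[1+ m ] j = begin
    fromℤ (-[1+ m ] ℤ.* j)                 ≡⟨ cong fromℤ (ℤ.neg-distribˡ-* (+ suc m) j) ⟨
    fromℤ (ℤ.- (+ suc m ℤ.* j))            ≡⟨ fromℤ-neg (+ suc m ℤ.* j) ⟩
    - fromℤ (+ suc m ℤ.* j)                ≡⟨ cong -_ (fromℤ-pos-* (suc m) j) ⟩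
    - (suc m ∙ 1# * fromℤ j)               ≡⟨ -‿distribˡ-* _ _ ⟩
    fromℤ -[1+ m ] * fromℤ j               ∎

  homomorphism : ℤ.+-*-rawRing -Raw-AlmostCommutative⟶ fromCommutativeRing commutativeRing
  homomorphism = record
    { ⟦_⟧ = fromℤ ; +-homo = fromℤ-+ ; *-homo = fromℤ-* ; -‿homo = fromℤ-neg
    -- `1-homo` holds by computation because the optimised multiple reduces `1 ∙ 1#` to `1#`.
    ; 0-homo = refl ; 1-homo = refl }

  _coeff≟_ : ∀ i j → Maybe (fromℤ i ≡ fromℤ j)
  i coeff≟ j with i ℤ.≟ j
  ... | yes i≡j = just (cong fromℤ i≡j)
  ... | no  _   = nothing

  open RingSolver ℤ.+-*-rawRing (fromCommutativeRing commutativeRing) homomorphism _coeff≟_ public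
    using (solve; _:=_; _:+_; _:*_; _:-_; :-_; con)

-- Finite sums and linear combinations.

module RealLinearAlgebra (R : Reals) where
  open Reals R
  open LinearAlgebra R
  open IntegerCoefficients R
  private module CR = CommutativeRing commutativeRing
  open RingProperties CR.ring using (-0#≈0#)
  open SemiringSum CR.semiring
    using (sum-cong-≗; sum-replicate-zero; sum-remove; ∑-distrib-+; ∑-comm; *-distribˡ-sum; *-distribʳ-sum)
  open IsStrictTotalOrder isStrictTotalOrder using () renaming (_≟_ to _≟ᴿ_)
  open ≡-Reasoning

  sum-zero : ∀ {n} (t : Fin n → ℝ) → (∀ i → t i ≡ 0#) → sum t ≡ 0#
  sum-zero {n} t t≡0 = trans (sum-cong-≗ t≡0) (sum-replicate-zero n)

  sum-neg : ∀ {n} (t : Fin n → ℝ) → sum (λ i → - t i) ≡ - sum t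
  sum-neg {zero}  t = sym -0#≈0#
  sum-neg {suc n} t = trans (cong (λ z → - t zero + z) (sum-neg (t ∘ suc)))
    (solve 2 (λ a b → :- a :- b := :- (a :+ b)) refl (t zero) (sum (t ∘ suc)))

  sum-single : ∀ {n} (t : Fin n → ℝ) i → (∀ j → j ≢ i → t j ≡ 0#) → sum t ≡ t i
  sum-single {suc n} t i t≡0 = begin
    sum t                    ≡⟨ sum-remove t ⟩
    t i + sum (removeAt t i) ≡⟨ cong (t i +_) (sum-zero _ λ j → t≡0 (punchIn i j) (punchInᵢ≢i i j)) ⟩
    t i + 0#                 ≡⟨ CR.+-identityʳ _ ⟩
    t i                      ∎

  sum-pair : ∀ {n} (t : Fin n → ℝ) {i j} → i ≢ j →
             (∀ k → k ≢ i → k ≢ j → t k ≡ 0#) → sum t ≡ t i + t j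
  sum-pair {suc n} t {i} {j} i≢j t≡0 = begin
    sum t                         ≡⟨ sum-remove t ⟩
    t i + sum (removeAt t i)      ≡⟨ cong (t i +_) (sum-single _ (punchOut i≢j) rest) ⟩
    t i + t (punchIn i (punchOut i≢j)) ≡⟨ cong (λ k → t i + t k) (punchIn-punchOut i≢j) ⟩
    t i + t j                     ∎
    where
    rest : ∀ k → k ≢ punchOut i≢j → t (punchIn i k) ≡ 0#
    rest k k≢ = t≡0 (punchIn i k) (punchInᵢ≢i i k) λ eq →
      k≢ (punchIn-injective i _ _ (trans eq (sym (punchIn-punchOut i≢j))))

  -- Associativity of the matrix product, with `combination` as row vector times matrix: distribute
  -- and exchange the two sums.
  combination-assoc : ∀ {l m n} (c : Fin l → ℝ) (y : Fin l → Fin m → ℝ) (z : Fin m → Fin n → ℝ) i →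
    combination (combination c y) z i ≡ combination c (λ k → combination (y k) z) i
  combination-assoc c y z i = begin
    sum (λ f → sum (λ k → c k * y k f) * z f i)
      ≡⟨ sum-cong-≗ (λ f → *-distribʳ-sum (z f i) (λ k → c k * y k f)) ⟩
    sum (λ f → sum λ k → c k * y k f * z f i)
      ≡⟨ ∑-comm (λ f k → c k * y k f * z f i) ⟩
    sum (λ k → sum λ f → c k * y k f * z f i)
      ≡⟨ sum-cong-≗ (λ k → sum-cong-≗ λ f → CR.*-assoc (c k) (y k f) (z f i)) ⟩
    sum (λ k → sum λ f → c k * (y k f * z f i))
      ≡⟨ sum-cong-≗ (λ k → *-distribˡ-sum (c k) (λ f → y k f * z f i)) ⟨
    sum (λ k → c k * sum λ f → y k f * z f i)
      ∎

  combination-minus : ∀ {m n} (c : Fin m → ℝ) (u v : Fin m → Fin n → ℝ) i →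
    combination c (λ k j → u k j - v k j) i ≡ combination c u i - combination c v i
  combination-minus c u v i = begin
    sum (λ k → c k * (u k i - v k i))
      ≡⟨ sum-cong-≗ (λ k → solve 3 (λ c u v → c :* (u :- v) := c :* u :+ :- (c :* v)) refl (c k) (u k i) (v k i)) ⟩
    sum (λ k → c k * u k i + - (c k * v k i))
      ≡⟨ ∑-distrib-+ (λ k → c k * u k i) (λ k → - (c k * v k i)) ⟩
    combination c u i + sum (λ k → - (c k * v k i))
      ≡⟨ cong (combination c u i +_) (sum-neg λ k → c k * v k i) ⟩
    combination c u i - combination c v i
      ∎

  combination-annihilates : ∀ {m n} (c : Fin m → ℝ) (v : Fin m → Fin n → ℝ) (l : Fin n → ℝ) →
    (∀ k → sum (λ i → v k i * l i) ≡ 0#) → sum (λ i → combination c v i * l i) ≡ 0#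
  combination-annihilates c v l v⊥l = trans
    -- The functional `l` enters as a matrix with a single column.
    (combination-assoc {n = 1} c v (λ i _ → l i) zero)
    (sum-zero _ λ k → trans (cong (c k *_) (v⊥l k)) (CR.zeroʳ _))

  -- Homogeneous linear systems.

  Nonzero : ∀ {n} → (Fin n → ℝ) → Set
  Nonzero a = ∃ λ k → a k ≢ 0#

  not-all-zero : ∀ {n} (a : Fin n → ℝ) → ¬ (∀ k → a k ≡ 0#) → Nonzero a
  not-all-zero {n} a = ¬∀⟶∃¬ n _ (λ k → a k ≟ᴿ 0#)

  -- Gaussian elimination, by induction on the number of equations. A zero first row imposes nothing
  -- and is dropped; otherwise a pivot removes one equation and one unknown.
  underdetermined : ∀ {m n} → m ℕ.< n → (A : Fin m → Fin n → ℝ) →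
    ∃ λ a → Nonzero a × (∀ i → sum (λ k → a k * A i k) ≡ 0#)
  underdetermined {zero} {suc n} _ A = (λ _ → 1#) , (zero , 0≢1 ∘ sym) , λ ()
  underdetermined {suc m} {suc n} (s<s m<n) A with all? (λ k → A zero k ≟ᴿ 0#)
  ... | yes r≡0 with underdetermined (m<n⇒m<1+n m<n) (A ∘ suc)
  ... | a , a≢0 , sol = a , a≢0 , λ
    { zero    → sum-zero _ λ k → trans (cong (a k *_) (r≡0 k)) (CR.zeroʳ (a k))
    ; (suc i) → sol i }
  underdetermined {suc m} {suc n} (s<s m<n) A | no r≢0 = a , (punchIn k₀ k , a-k≢0) , solves
    where
    r : Fin (suc n) → ℝ
    r = A zero

    pivot : Nonzero r
    pivot = not-all-zero r r≢0

    k₀ : Fin (suc n)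
    k₀ = proj₁ pivot

    q : ℝ
    q = proj₁ (inverse (r k₀) (proj₂ pivot))

    rq≡1 : r k₀ * q ≡ 1#
    rq≡1 = proj₂ (inverse (r k₀) (proj₂ pivot))

    -- Each remaining row minus the multiple of the first row that clears column `k₀`; `q` is the
    -- inverse of the pivot.
    reduced : Fin m → Fin n → ℝ
    reduced i k = A (suc i) (punchIn k₀ k) - A (suc i) k₀ * q * r (punchIn k₀ k)

    smaller : ∃ λ a → Nonzero a × (∀ i → sum (λ k → a k * reduced i k) ≡ 0#)
    smaller = underdetermined m<n reduced

    a′ : Fin n → ℝ
    a′ = proj₁ smaller

    k : Fin n
    k = proj₁ (proj₁ (proj₂ smaller))

    rest : (Fin (suc n) → ℝ) → ℝ
    rest t = sum λ k → a′ k * t (punchIn k₀ k)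

    a : Fin (suc n) → ℝ
    -- The pivot coordinate is found by solving the first equation for it.
    a = insertAt a′ k₀ (- (q * rest r))

    a-k≢0 : a (punchIn k₀ k) ≢ 0#
    a-k≢0 eq = proj₂ (proj₁ (proj₂ smaller)) (trans (sym (insertAt-punchIn a′ k₀ _ k)) eq)

    split : ∀ t → sum (λ k → a k * t k) ≡ - (q * rest r) * t k₀ + rest t
    split t = trans (sum-remove {i = k₀} (λ k → a k * t k)) (cong₂ _+_
      (cong (_* t k₀) (insertAt-lookup a′ k₀ _))
      (sum-cong-≗ λ k → cong (_* t (punchIn k₀ k)) (insertAt-punchIn a′ k₀ _ k)))

    reduced-sum : ∀ i → rest (A (suc i)) - A (suc i) k₀ * q * rest r ≡ 0#
    reduced-sum i = begin
      rest (A (suc i)) - c * rest r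
        ≡⟨ cong (λ z → rest (A (suc i)) - z) (trans (*-distribˡ-sum c (λ k → a′ k * r (punchIn k₀ k))) (sum-cong-≗ λ k →
             solve 3 (λ c a r → c :* (a :* r) := a :* (c :* r)) refl c (a′ k) (r (punchIn k₀ k)))) ⟩
      rest (A (suc i)) - sum (λ k → a′ k * (c * r (punchIn k₀ k)))
        ≡⟨ combination-minus {n = 1} a′ (λ k _ → A (suc i) (punchIn k₀ k)) (λ k _ → c * r (punchIn k₀ k)) zero ⟨
      sum (λ k → a′ k * reduced i k)
        ≡⟨ proj₂ (proj₂ smaller) i ⟩
      0# ∎
      where c = A (suc i) k₀ * q

    solves : ∀ i → sum (λ k → a k * A i k) ≡ 0#
    solves zero = begin
      sum (λ k → a k * r k)
        ≡⟨ split r ⟩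
      - (q * rest r) * r k₀ + rest r
        ≡⟨ solve 3 (λ q s p → :- (q :* s) :* p :+ s := s :* (con 1ℤ :- p :* q)) refl q (rest r) (r k₀) ⟩
      rest r * (1# - r k₀ * q)
        ≡⟨ cong (λ z → rest r * (1# - z)) rq≡1 ⟩
      rest r * (1# - 1#)
        ≡⟨ solve 1 (λ s → s :* (con 1ℤ :- con 1ℤ) := con 0ℤ) refl (rest r) ⟩
      0# ∎
    solves (suc i) = begin
      sum (λ k → a k * A (suc i) k)
        ≡⟨ split (A (suc i)) ⟩
      - (q * rest r) * A (suc i) k₀ + rest (A (suc i))
        ≡⟨ solve 4 (λ q s b t → :- (q :* s) :* b :+ t := t :- b :* q :* s) refl q (rest r) (A (suc i) k₀) (rest (A (suc i))) ⟩
      rest (A (suc i)) - A (suc i) k₀ * q * rest r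
        ≡⟨ reduced-sum i ⟩
      0# ∎

-- The lift of a self-stress as a cellular cycle.

module SurfaceLifting {R : Reals} (S : PolygonalSurface R) where
  open Reals R
  open Plane R
  open LinearAlgebra R
  open PolygonalSurface S
  open IntegerCoefficients R
  open RealLinearAlgebra R
  private module CR = CommutativeRing commutativeRing
  open SemiringSum CR.semiring using (sum-cong-≗; ∑-distrib-+; *-distribˡ-sum; *-distribʳ-sum)
  open ≡-Reasoning

  Face : Set
  Face = Fin #F

  -- The elementary lift across e, in the reference direction of e.
  edgeLift : Stress S → ℝ² → Fin #E → ℝ
  edgeLift w x e = det (p ⊖ q) (p ⊖ x) * w e
    where
    p = pos (tail (e , Sign.+))
    q = pos (head (e , Sign.+))

  edgeLift-combination : ∀ {d} (c : Fin d → ℝ) (v : Fin d → Stress S) x e →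
    edgeLift (combination c v) x e ≡ combination c (λ k → edgeLift (v k) x) e
  edgeLift-combination c v x e = trans
    (*-distribˡ-sum D (λ k → c k * v k e))
    (sum-cong-≗ λ k → solve 3 (λ a b c → a :* (b :* c) := b :* (a :* c)) refl D (c k) (v k e))
    where
    D = det (pos (tail (e , Sign.+)) ⊖ pos (head (e , Sign.+))) (pos (tail (e , Sign.+)) ⊖ x)

  -- The force with its stress factored out, so that equilibrium pairs `w` with a vector depending
  -- only on the placement of the framework.
  arm : Fin #V → Dart → ℝ²
  arm v a = if does (tail a ≟ v) then pos (tail a) ⊖ pos (head a) else (0# , 0#)

  force-arm : ∀ w v a → force S w v a ≡ (w (edge a) * proj₁ (arm v a) , w (edge a) * proj₂ (arm v a))
  force-arm w v a with does (tail a ≟ v)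
  ... | true  = refl
  ... | false = sym (cong₂ _,_ (CR.zeroʳ _) (CR.zeroʳ _))

  bothArms : (ℝ² → ℝ) → Fin #V → Fin #E → ℝ
  bothArms π v e = π (arm v (e , Sign.+)) + π (arm v (e , Sign.-))

  force-sum₁ : ∀ w v → sum (λ e → proj₁ (force S w v (e , Sign.+)) + proj₁ (force S w v (e , Sign.-)))
                     ≡ sum (λ e → w e * bothArms proj₁ v e)
  force-sum₁ w v = sum-cong-≗ λ e → trans
    (cong₂ (λ f g → proj₁ f + proj₁ g) (force-arm w v (e , Sign.+)) (force-arm w v (e , Sign.-)))
    (sym (CR.distribˡ _ _ _))

  force-sum₂ : ∀ w v → sum (λ e → proj₂ (force S w v (e , Sign.+)) + proj₂ (force S w v (e , Sign.-)))
                     ≡ sum (λ e → w e * bothArms proj₂ v e)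
  force-sum₂ w v = sum-cong-≗ λ e → trans
    (cong₂ (λ f g → proj₂ f + proj₂ g) (force-arm w v (e , Sign.+)) (force-arm w v (e , Sign.-)))
    (sym (CR.distribˡ _ _ _))

  selfStress-combination : ∀ {d} (c : Fin d → ℝ) (v : Fin d → Stress S) →
    (∀ k → SelfStress S (v k)) → SelfStress S (combination c v)
  selfStress-combination c v ss u =
    trans (force-sum₁ (combination c v) u) (combination-annihilates c v (bothArms proj₁ u)
      λ k → trans (sym (force-sum₁ (v k) u)) (proj₁ (ss k u))) ,
    trans (force-sum₂ (combination c v) u) (combination-annihilates c v (bothArms proj₂ u)
      λ k → trans (sym (force-sum₂ (v k) u)) (proj₂ (ss k u)))

  -- Summed over e, this says that the flow of edgeLift w x into v is the moment
  -- det (p - x) F of the total force F at p = pos v.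
  edgeLift-flow : ∀ w x v e →
    edgeLift w x e * ([_at_] S (head (e , Sign.+)) v - [_at_] S (tail (e , Sign.+)) v)
      ≡ w e * bothArms proj₁ v e * (proj₂ x - proj₂ (pos v))
      + w e * bothArms proj₂ v e * (proj₁ (pos v) - proj₁ x)
  edgeLift-flow w x v e with tail (e , Sign.+) ≟ v | head (e , Sign.+) ≟ v
  ... | yes t≡v | yes h≡v = contradiction (trans t≡v (sym h≡v)) (loopless (e , Sign.+))
  ... | yes refl | no _ = solve 7
    (λ p₁ p₂ q₁ q₂ x₁ x₂ w →
      ((p₁ :- q₁) :* (p₂ :- x₂) :- (p₂ :- q₂) :* (p₁ :- x₁)) :* w :* (con 0ℤ :- con 1ℤ)
      := w :* ((p₁ :- q₁) :+ con 0ℤ) :* (x₂ :- p₂) :+ w :* ((p₂ :- q₂) :+ con 0ℤ) :* (p₁ :- x₁))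
    refl _ _ _ _ _ _ _
  ... | no _ | yes refl = solve 7
    (λ p₁ p₂ q₁ q₂ x₁ x₂ w →
      ((p₁ :- q₁) :* (p₂ :- x₂) :- (p₂ :- q₂) :* (p₁ :- x₁)) :* w :* (con 1ℤ :- con 0ℤ)
      := w :* (con 0ℤ :+ (q₁ :- p₁)) :* (x₂ :- q₂) :+ w :* (con 0ℤ :+ (q₂ :- p₂)) :* (q₁ :- x₁))
    refl _ _ _ _ _ _ _
  ... | no _ | no _ = solve 4
    (λ l w a b → l :* (con 0ℤ :- con 0ℤ)
      := w :* (con 0ℤ :+ con 0ℤ) :* a :+ w :* (con 0ℤ :+ con 0ℤ) :* b)
    refl (edgeLift w x e) (w e) (proj₂ x - proj₂ (pos v)) (proj₁ (pos v) - proj₁ x)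

  -- By `edgeLift-flow` the boundary at `v` combines the two coordinates of the total force with
  -- factors `A` and `B` that do not depend on the edge. Equilibrium makes both coordinates vanish.
  edgeLift-cycle : ∀ {w} → SelfStress S w → ∀ x → IsCycle S (edgeLift w x)
  edgeLift-cycle {w} ss x v = begin
    ∂₁ S (edgeLift w x) v
      ≡⟨ sum-cong-≗ (edgeLift-flow w x v) ⟩
    sum (λ e → F proj₁ e * A + F proj₂ e * B)
      ≡⟨ ∑-distrib-+ (λ e → F proj₁ e * A) (λ e → F proj₂ e * B) ⟩
    sum (λ e → F proj₁ e * A) + sum (λ e → F proj₂ e * B)
      ≡⟨ cong₂ _+_ (*-distribʳ-sum A (F proj₁)) (*-distribʳ-sum B (F proj₂)) ⟨
    sum (F proj₁) * A + sum (F proj₂) * B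
      ≡⟨ cong₂ (λ f g → f * A + g * B) (trans (sym (force-sum₁ w v)) (proj₁ (ss v)))
                                       (trans (sym (force-sum₂ w v)) (proj₂ (ss v))) ⟩
    0# * A + 0# * B
      ≡⟨ solve 2 (λ a b → con 0ℤ :* a :+ con 0ℤ :* b := con 0ℤ) refl A B ⟩
    0# ∎
    where
    A = proj₂ x - proj₂ (pos v)
    B = proj₁ (pos v) - proj₁ x
    F : (ℝ² → ℝ) → Fin #E → ℝ
    F π e = w e * bothArms π v e

  -- Affine dependence on the point of evaluation.

  basePoint : Fin 3 → ℝ²
  basePoint zero             = 0# , 0#
  basePoint (suc zero)       = 1# , 0#
  basePoint (suc (suc zero)) = 0# , 1#

  barycentric : ℝ² → Fin 3 → ℝ
  barycentric (x₁ , x₂) zero             = 1# - x₁ - x₂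
  barycentric (x₁ , x₂) (suc zero)       = x₁
  barycentric (x₁ , x₂) (suc (suc zero)) = x₂

  -- `x` occurs only in the second argument of the bilinear `det`, so the lift is affine in `x` and
  -- fixed by its values at three affinely independent points.
  edgeLift-affine : ∀ w x e →
    edgeLift w x e ≡ combination (barycentric x) (λ m → edgeLift w (basePoint m)) e
  edgeLift-affine w x e = solve 7
    (λ p₁ p₂ q₁ q₂ x₁ x₂ w →
      let D = λ y₁ y₂ → ((p₁ :- q₁) :* (p₂ :- y₂) :- (p₂ :- q₂) :* (p₁ :- y₁)) :* w
      in D x₁ x₂ := (con 1ℤ :- x₁ :- x₂) :* D (con 0ℤ) (con 0ℤ)
                    -- The last `con 0ℤ` is the empty tail of the sum over `Fin 3`.
                    :+ (x₁ :* D (con 1ℤ) (con 0ℤ) :+ (x₂ :* D (con 0ℤ) (con 1ℤ) :+ con 0ℤ)))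
    refl _ _ _ _ _ _ _

  -- Boundaries of 2-chains.

  -- `∂₂` is itself a `combination` with the incidence matrix, so its linearity is an instance of
  -- associativity.
  ∂₂-combination : ∀ {n} (c : Fin n → ℝ) (y : Fin n → Face → ℝ) e →
    ∂₂ S (combination c y) e ≡ combination c (λ k → ∂₂ S (y k)) e
  ∂₂-combination c y = combination-assoc c y (λ f e → sum λ i → incidence S (side f i) e)

  boundary-combination : ∀ {n} (c : Fin n → ℝ) (v : Fin n → Fin #E → ℝ) →
    (∀ k → IsBoundary S (v k)) → IsBoundary S (combination c v)
  boundary-combination c v bd = combination c (proj₁ ∘ bd) , λ e → trans
    (∂₂-combination c (proj₁ ∘ bd) e) (sum-cong-≗ λ k → cong (c k *_) (proj₂ (bd k) e))

  incidence-other : ∀ b e → edge b ≢ e → incidence S b e ≡ 0#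
  incidence-other b e b≢e = cong (if_then signed S (proj₂ b) 1# else 0#) (dec-false (edge b ≟ e) b≢e)

  incidence-same : ∀ e s → incidence S (e , s) e ≡ signed S s 1#
  incidence-same e s = cong (if_then signed S s 1# else 0#) (dec-true (e ≟ e) refl)

  -- An edge occurs at most twice among all sides, and the given sides of `f` and `g` account for
  -- both occurrences. Every other face contributes zero, and `f` and `g` contribute one incidence
  -- each.
  ∂₂-two-sides : ∀ y e {f g} → f ≢ g → ∀ {i j s t} → side f i ≡ (e , s) → side g j ≡ (e , t) →
    ∂₂ S y e ≡ y f * signed S s 1# + y g * signed S t 1#
  ∂₂-two-sides y e {f} {g} f≢g {i} {j} {s} {t} fi gj = begin
    ∂₂ S y e
      ≡⟨ sum-pair _ f≢g (λ k k≢f k≢g → trans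
           (cong (y k *_) (sum-zero (λ l → incidence S (side k l) e) λ l →
             incidence-other (side k l) e λ kl →
               k≢f (cong proj₁ (only f≢g fi gj kl (k≢g ∘ cong proj₁)))))
           (CR.zeroʳ (y k))) ⟩
    y f * sum (λ l → incidence S (side f l) e) + y g * sum (λ l → incidence S (side g l) e)
      ≡⟨ cong₂ (λ u v → y f * u + y g * v) (one f≢g fi gj) (one (f≢g ∘ sym) gj fi) ⟩
    y f * signed S s 1# + y g * signed S t 1#
      ∎
    where
    only : ∀ {f g i j s t} → f ≢ g → side f i ≡ (e , s) → side g j ≡ (e , t) →
           ∀ {k l} → edge (side k l) ≡ e → (k , l) ≢ (g , j) → (k , l) ≡ (f , i)
    only {f} {g} {i} {j} f≢g fi gj {k} {l} kl kl≢gj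
      with atMostTwice (k , l) (f , i) (g , j) (trans kl (cong proj₁ (sym fi)))
                       (trans (cong proj₁ fi) (cong proj₁ (sym gj)))
    ... | inj₁ eq        = eq
    ... | inj₂ (inj₁ eq) = contradiction (cong proj₁ eq) f≢g
    ... | inj₂ (inj₂ eq) = contradiction eq kl≢gj

    same-face : ∀ {f i l} → _≡_ {A = Side} (f , l) (f , i) → l ≡ i
    same-face refl = refl

    one : ∀ {f g i j s t} → f ≢ g → side f i ≡ (e , s) → side g j ≡ (e , t) →
          sum (λ l → incidence S (side f l) e) ≡ signed S s 1#
    one {f} {i = i} {s = s} f≢g fi gj = begin
      sum (λ l → incidence S (side f l) e)
        ≡⟨ sum-single _ i (λ l l≢i → incidence-other (side f l) e λ fl →
             l≢i (same-face (only f≢g fi gj fl (f≢g ∘ cong proj₁)))) ⟩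
      incidence S (side f i) e
        ≡⟨ cong (λ b → incidence S b e) fi ⟩
      incidence S (e , s) e
        ≡⟨ incidence-same e s ⟩
      signed S s 1# ∎

  -- Orientations and lifts across darts.

  side-∈∂ : ∀ {a f} s → _∈∂_ S a (f , s) → ∃ λ i → side f i ≡ (edge a , s Sign.* proj₂ a)
  side-∈∂ Sign.+ (i , refl) = i , refl
  side-∈∂ {f = f} Sign.- (i , refl) = i , cong (edge (side f i) ,_) (sym (opposite-involutive _))

  -- The two orientations of a face traverse a given side in opposite directions, so one of them
  -- runs along `a`.
  ∈∂-side : ∀ a {f i} → edge (side f i) ≡ edge a → ∃ λ s → _∈∂_ S a (f , s)
  ∈∂-side (e , σ) {f} {i} eq with side f i in fi
  ∈∂-side (e , Sign.+) {i = i} refl | _ , Sign.+ = Sign.+ , i , fi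
  ∈∂-side (e , Sign.-) {i = i} refl | _ , Sign.- = Sign.+ , i , fi
  ∈∂-side (e , Sign.+) {i = i} refl | _ , Sign.- = Sign.- , i , cong rev fi
  ∈∂-side (e , Sign.-) {i = i} refl | _ , Sign.+ = Sign.- , i , cong rev fi

  dartLift : Stress S → Dart → ℝ² → ℝ
  dartLift w a x = det (pos (tail a) ⊖ pos (head a)) (pos (tail a) ⊖ x) * w (edge a)

  -- Exchanging `p` and `q` negates the determinant, because `q - x` and `p - x` differ by a
  -- multiple of `p - q`. The lift is thus antisymmetric, as a 1-chain must be.
  dartLift-edgeLift : ∀ w a x → dartLift w a x ≡ signed S (proj₂ a) (edgeLift w x (edge a))
  dartLift-edgeLift w (e , Sign.+) x = refl
  dartLift-edgeLift w (e , Sign.-) x = solve 7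
    (λ p₁ p₂ q₁ q₂ x₁ x₂ w →
      ((p₁ :- q₁) :* (p₂ :- x₂) :- (p₂ :- q₂) :* (p₁ :- x₁)) :* w
      := :- (((q₁ :- p₁) :* (q₂ :- x₂) :- (q₂ :- p₂) :* (q₁ :- x₁)) :* w))
    refl _ _ _ _ _ _ _

  -- For `x` on the line `pq` the vectors `p - q` and `p - x` are parallel. This makes lifts agree
  -- along shared edges.
  dartLift-onDart : ∀ w a r → dartLift w a (onDart a r) ≡ 0#
  dartLift-onDart w a r = solve 6
    (λ p₁ p₂ q₁ q₂ r w →
      ((p₁ :- q₁) :* (p₂ :- (p₂ :+ r :* (q₂ :- p₂))) :- (p₂ :- q₂) :* (p₁ :- (p₁ :+ r :* (q₁ :- p₁)))) :* w
      := con 0ℤ)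
    refl _ _ _ _ _ _

  -- Faces with agreeing orientations `s` and `t` list an edge with signs `s * σ` and
  -- `t * opposite σ`; multiplying by `σ` leaves `s` and the negative of `t`.
  crossing-signs : ∀ σ s t u v →
    signed S σ (u * signed S (s Sign.* σ) 1# + v * signed S (t Sign.* opposite σ) 1#)
      ≡ signed S s u - signed S t v
  crossing-signs Sign.+ Sign.+ Sign.+ = solve 2 (λ u v → u :* con 1ℤ :+ v :* :- con 1ℤ := u :- v) refl
  crossing-signs Sign.+ Sign.+ Sign.- = solve 2 (λ u v → u :* con 1ℤ :+ v :* con 1ℤ := u :- :- v) refl
  crossing-signs Sign.+ Sign.- Sign.+ = solve 2 (λ u v → u :* :- con 1ℤ :+ v :* :- con 1ℤ := :- u :- v) refl
  crossing-signs Sign.+ Sign.- Sign.- = solve 2 (λ u v → u :* :- con 1ℤ :+ v :* con 1ℤ := :- u :- :- v) refl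
  crossing-signs Sign.- Sign.+ Sign.+ = solve 2 (λ u v → :- (u :* :- con 1ℤ :+ v :* con 1ℤ) := u :- v) refl
  crossing-signs Sign.- Sign.+ Sign.- = solve 2 (λ u v → :- (u :* :- con 1ℤ :+ v :* :- con 1ℤ) := u :- :- v) refl
  crossing-signs Sign.- Sign.- Sign.+ = solve 2 (λ u v → :- (u :* con 1ℤ :+ v :* con 1ℤ) := :- u :- v) refl
  crossing-signs Sign.- Sign.- Sign.- = solve 2 (λ u v → :- (u :* con 1ℤ :+ v :* :- con 1ℤ) := :- u :- :- v) refl

  -- A bounding 2-chain as a potential for the lift.

  module Potential (w : Stress S) (y : ℝ² → Face → ℝ)
                   (∂y : ∀ x e → ∂₂ S (y x) e ≡ edgeLift w x e) where

    potential : ℝ² → OrientedFace S → ℝ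
    potential x (f , s) = signed S s (y x f)

    dartLift-potential : ∀ {a f g s t} → f ≢ g → _∈∂_ S a (f , s) → _∈∂_ S (rev a) (g , t) →
      ∀ x → dartLift w a x ≡ potential x (f , s) - potential x (g , t)
    dartLift-potential {a} {f} {g} {s} {t} f≢g a∈f a∈g x = begin
      dartLift w a x
        ≡⟨ dartLift-edgeLift w a x ⟩
      signed S (proj₂ a) (edgeLift w x (edge a))
        ≡⟨ cong (signed S (proj₂ a)) (∂y x (edge a)) ⟨
      signed S (proj₂ a) (∂₂ S (y x) (edge a))
        ≡⟨ cong (signed S (proj₂ a))
             (∂₂-two-sides (y x) (edge a) f≢g (proj₂ (side-∈∂ s a∈f)) (proj₂ (side-∈∂ t a∈g))) ⟩
      signed S (proj₂ a) (y x f * signed S (s Sign.* proj₂ a) 1# + y x g * signed S (t Sign.* opposite (proj₂ a)) 1#)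
        ≡⟨ crossing-signs (proj₂ a) s t (y x f) (y x g) ⟩
      potential x (f , s) - potential x (g , t)
        ∎

    step-potential : ∀ {φ ψ} (σ : Step S φ ψ) x → elementaryLift S w σ x ≡ potential x φ - potential x ψ
    step-potential (cross a f≢g a∈f a∈g) x = trans (CR.*-identityʳ _) (dartLift-potential f≢g a∈f a∈g x)
    -- A repeated face keeps its orientation, so its potential cancels, matching `ρ = 0#`.
    step-potential {φ} (stay _ _) x = trans (CR.zeroʳ _) (sym (CR.-‿inverseʳ (potential x φ)))

    τ-potential : ∀ {φ ψ} (γ : OrientedFacePath S φ ψ) x → τ S γ w x ≡ potential x φ - potential x ψ
    τ-potential [ σ ]   x = step-potential σ x
    τ-potential {φ} {ψ} (_∷_ {y = χ} σ γ) x = trans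
      (cong₂ _+_ (step-potential σ x) (τ-potential γ x))
      (solve 3 (λ a b c → (a :- b) :+ (b :- c) := a :- c) refl
        (potential x φ) (potential x χ) (potential x ψ))

    monodromyFree : MonodromyFree S w
    monodromyFree φ γ x = trans (τ-potential γ x) (CR.-‿inverseʳ (potential x φ))

    -- Both paths start at `φ`, so the lifts differ by the jump of the potential across `a`. That
    -- jump is the lift across `a`, which vanishes along its edge.
    compatible : ∀ {φ g h t u} (γ : OrientedFacePath S φ (g , t)) (γ′ : OrientedFacePath S φ (h , u)) a →
      g ≢ h → _∈∂_ S a (g , t) → _∈∂_ S (rev a) (h , u) → ∀ r → τ S γ w (onDart a r) ≡ τ S γ′ w (onDart a r)
    compatible {φ} {g} {h} {t} {u} γ γ′ a g≢h a∈g a∈h r = begin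
      τ S γ w x
        ≡⟨ τ-potential γ x ⟩
      potential x φ - potential x (g , t)
        ≡⟨ solve 3 (λ p q r → p :- q := p :- r :- (q :- r)) refl
             (potential x φ) (potential x (g , t)) (potential x (h , u)) ⟩
      potential x φ - potential x (h , u) - (potential x (g , t) - potential x (h , u))
        ≡⟨ cong₂ _-_ (sym (τ-potential γ′ x)) (trans (sym (dartLift-potential g≢h a∈g a∈h x)) (dartLift-onDart w a r)) ⟩
      τ S γ′ w x - 0#
        ≡⟨ solve 1 (λ p → p :- con 0ℤ := p) refl (τ S γ′ w x) ⟩
      τ S γ′ w x
        ∎
      where x = onDart a r

  -- Existence of oriented face-paths.

  Reachable : OrientedFace S → Face → Set
  Reachable φ g = ∃ λ t → OrientedFacePath S φ (g , t)

  boundary-dart : ∀ g i t → ∃ λ a → edge a ≡ edge (side g i) × _∈∂_ S a (g , t)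
  boundary-dart g i Sign.+ = side g i , refl , i , refl
  boundary-dart g i Sign.- = rev (side g i) , refl , i , refl

  -- For distinct faces the path is extended by one crossing, and agreement at the common edge
  -- dictates the orientation of the new face.
  reachable-neighbour : ∀ {φ g h i j} → edge (side g i) ≡ edge (side h j) → Reachable φ g → Reachable φ h
  reachable-neighbour {g = g} {h} {i} {j} eq (t , γ) with g ≟ h
  ... | yes refl = t , γ
  ... | no g≢h =
    let a , a≡ , a∈g = boundary-dart g i t
        u , a∈h      = ∈∂-side (rev a) (trans (sym eq) (sym a≡))
    in u , γ ∷ʳ cross a g≢h a∈g a∈h

  -- Reachability is carried by edges, for all faces along them at once, since connectedness is
  -- given for links and for the 1-skeleton.
  EdgeReached : OrientedFace S → Fin #E → Set
  EdgeReached φ e = ∀ g i → edge (side g i) ≡ e → Reachable φ g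

  reached-via : ∀ {φ} f i → Reachable φ f → EdgeReached φ (edge (side f i))
  reached-via f i r g j eq = reachable-neighbour {i = i} {j} (sym eq) r

  reached-corner : ∀ {φ a b} → Corner a b → EdgeReached φ (edge a) → EdgeReached φ (edge b)
  reached-corner (f , i , refl , refl) r = reached-via f (next i) (r f i refl)

  reached-corner⁻ : ∀ {φ a b} → Corner a b → EdgeReached φ (edge b) → EdgeReached φ (edge a)
  reached-corner⁻ (f , i , refl , refl) r = reached-via f i (r f (next i) refl)

  reached-link : ∀ {φ a b} → EqClosure Corner a b → EdgeReached φ (edge a) → EdgeReached φ (edge b)
  reached-link ε           r = r
  reached-link (fwd c ◅ l) r = reached-link l (reached-corner c r)
  reached-link (bwd c ◅ l) r = reached-link l (reached-corner⁻ c r)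

  -- The invariant is that every edge at the current vertex is reached. After a step along `a`,
  -- connectedness of the next link spreads this from `rev a` to all darts there.
  reached-walk : ∀ {φ u v} → Star Adjacent u v →
    (∀ a → tail a ≡ u → EdgeReached φ (edge a)) → ∀ b → tail b ≡ v → EdgeReached φ (edge b)
  reached-walk ε r = r
  reached-walk ((a , a≡u , a≡v) ◅ walk) r = reached-walk walk λ b b≡ →
    reached-link (linkConnected (rev a) b (trans a≡v (sym b≡))) (r a a≡u)

  firstSide : ∀ f → Fin (size f)
  firstSide f = fromℕ< {0} (≤-trans (s≤s z≤n) (3≤size f))

  reachable : ∀ φ g → Reachable φ g
  reachable (f , s) g =
    reached-walk (connected (tail b) (tail c)) near-b c refl g (firstSide g) refl
    where
    b = side f (firstSide f)
    c = side g (firstSide g)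

    -- Face-paths have at least one step, so the initial face is reached by staying.
    start-reached : Reachable (f , s) f
    start-reached = let a , _ , a∈f = boundary-dart f (firstSide f) s in s , [ stay a a∈f ]

    near-b : ∀ a → tail a ≡ tail b → EdgeReached (f , s) (edge a)
    near-b a a≡b = reached-link (linkConnected b a (sym a≡b)) (reached-via f (firstSide f) start-reached)

  boundary-lifting : ∀ w → (∀ m → IsBoundary S (edgeLift w (basePoint m))) → MonodromyFree S w × LiftingDefined S w
  boundary-lifting w bd = monodromyFree , record
    { reachable   = reachable
    ; independent = λ γ γ′ x → trans (τ-potential γ x) (sym (τ-potential γ′ x))
    ; compatible  = λ γ γ′ a g≢h a∈g a∈h r _ _ → compatible γ γ′ a g≢h a∈g a∈h r }
    where
    y : ℝ² → Face → ℝ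
    -- The bounding chains at the three base points are interpolated with the weights that
    -- interpolate the lift itself.
    y x = combination (barycentric x) (proj₁ ∘ bd)

    ∂y : ∀ x e → ∂₂ S (y x) e ≡ edgeLift w x e
    ∂y x e = trans
      (proj₂ (boundary-combination (barycentric x) (λ m → edgeLift w (basePoint m)) bd) e)
      (sym (edgeLift-affine w x e))

    open Potential w y ∂y

  -- Choice of the self-stress by counting dimensions.

  -- The rows `c k` are the coordinates of `v k` modulo boundaries. If `a` annihilates them,
  -- associativity removes the whole contribution of `h`.
  boundary-modulo : ∀ {n b} (a : Fin n → ℝ) (v : Fin n → Fin #E → ℝ)
    (c : Fin n → Fin b → ℝ) (h : Fin b → Fin #E → ℝ) →
    (∀ k → IsBoundary S (λ e → v k e - combination (c k) h e)) →
    (∀ j → combination a c j ≡ 0#) → IsBoundary S (combination a v)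
  boundary-modulo a v c h bd ac≡0 = proj₁ combined , λ e → trans (proj₂ combined e) (begin
    combination a (λ k e → v k e - combination (c k) h e) e
      ≡⟨ combination-minus a v (λ k → combination (c k) h) e ⟩
    combination a v e - combination a (λ k → combination (c k) h) e
      ≡⟨ cong (λ z → combination a v e - z) (trans (sym (combination-assoc a c h e))
           (sum-zero _ λ j → trans (cong (_* h j e) (ac≡0 j)) (CR.zeroˡ (h j e)))) ⟩
    combination a v e - 0#
      ≡⟨ solve 1 (λ p → p :- con 0ℤ := p) refl (combination a v e) ⟩
    combination a v e
      ∎)
    where
    combined = boundary-combination a (λ k e → v k e - combination (c k) h e) bd

  lifting : ∀ {d b₁} → Dimension (SelfStress S) d → FirstBetti S b₁ → 3 ℕ.* b₁ ℕ.< d →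
    ∃ λ (w : Stress S) →
      SelfStress S w × (∃ λ e → w e ≢ 0#) × MonodromyFree S w × LiftingDefined S w
  lifting {d} {b₁} (v , v-ss , v-independent , _) (h , _ , _ , h-spans) 3b₁<d =
    w , selfStress-combination a v v-ss , w≢0 , boundary-lifting w w-boundary
    where
    -- Coordinates in first homology of the lift cycle of the `k`-th basis stress at the `m`-th base
    -- point.
    class : ∀ m k → ∃ λ c → IsBoundary S (λ e → edgeLift (v k) (basePoint m) e - combination c h e)
    class m k = h-spans _ (edgeLift-cycle (v-ss k) (basePoint m))

    coordinate : Fin 3 × Fin b₁ → Fin d → ℝ
    coordinate (m , j) k = proj₁ (class m k) j

    -- One equation per pair of a base point and a homology coordinate, numbered by `remQuot`:
    -- `3 * b₁` equations in `d` unknowns.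
    kernel : ∃ λ a → Nonzero a × (∀ i → sum (λ k → a k * coordinate (remQuot b₁ i) k) ≡ 0#)
    kernel = underdetermined 3b₁<d (coordinate ∘ remQuot b₁)

    a : Fin d → ℝ
    a = proj₁ kernel

    w : Stress S
    w = combination a v

    w≢0 : Nonzero w
    -- Independence of the basis stresses turns a nonzero coefficient vector into a nonzero stress.
    w≢0 = not-all-zero w λ w≡0 →
      let (k , a-k≢0) , _ = proj₂ kernel in a-k≢0 (v-independent a w≡0 k)

    w-boundary : ∀ m → IsBoundary S (edgeLift w (basePoint m))
    w-boundary m = proj₁ bd , λ e → trans (proj₂ bd e) (sym (edgeLift-combination a v (basePoint m) e))
      where
      bd = boundary-modulo a (λ k → edgeLift (v k) (basePoint m)) (proj₁ ∘ class m) h (proj₂ ∘ class m)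
        λ j → subst (λ mj → sum (λ k → a k * coordinate mj k) ≡ 0#) (remQuot-combine m j)
          (proj₂ (proj₂ kernel) (combine m j))

open import Data.Nat.Base using (_<_; _*_)

theorem3p9 : (R : Reals) (S : PolygonalSurface R) (d b₁ : ℕ) →
    LinearAlgebra.Dimension R (SelfStress S) d → FirstBetti S b₁ → 3 * b₁ < d →
    ∃ λ (w : Stress S) →
      SelfStress S w × (∃ λ e → w e ≢ Reals.0# R) × MonodromyFree S w × LiftingDefined S w
theorem3p9 R S d b₁ = SurfaceLifting.lifting S
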